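{- Let $\Gamma$ be any context of $\lambda\mathsf{HOL}$ (possibly extended by constants and additional conversion rules) in which there are a type $A:\square$ and terms $\mathsf{intro}:T\,A\to A$ and $\mathsf{match}:A\to T\,A$ such that $\mathsf{match}\circ\mathsf{intro}$ is judgementally equal to $T\,(\mathsf{intro}\circ\mathsf{match})$; explicitly, for all $u:T\,A$ and $p:\mathsf{Pow}\,A$, $\mathsf{match}\,(\mathsf{intro}\,u)\,p$ is judgementally equal to $u\,(\lambda_{x:A}\,p\,(\mathsf{intro}\,(\mathsf{match}\,x)))$. Then there is a term of type $\perp$ in $\Gamma$.
   Context: $\lambda\mathsf{HOL}$ (minimal higher-order logic) is the pure type system with sorts $*,\square,\Delta$, axioms $*:\square$ and $\square:\Delta$, and rules $(*,*)$, $(\square,\square)$, $(\square,*)$; judgemental equality is $\beta$-conversion. Define $\mathsf{Pow}\,X = X\to *$ and $T\,X=\mathsf{Pow}(\mathsf{Pow}\,X)$. For $f:X\to Y$, define $T\,f:T\,X\to T\,Y$ by $T\,f\,F\,q = F\,(\lambda_{x:X}\,q\,(f\,x))$, and $g\circ f=\lambda_{x:X}\,g\,(f\,x)$. Define $\perp:*$ by $\perp=\forall_{p:*}\,p$. -}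

module Defs where

open import Data.Fin.Base using (Fin; zero; suc)
open import Data.Fin.Substitution using (Sub; Lift; TermSubst)
open import Data.List.Base using (List)
open import Data.List.Relation.Unary.All using (All)
open import Data.Nat.Base using (ℕ; zero; suc)
open import Data.Product.Base using (_×_; _,_)
open import Data.Vec.Base using (Vec; []; _∷_; lookup)

data Sort : Set where
  ⋆ □ △ : Sort

data Axiom : Sort → Sort → Set where
  ⋆∶□ : Axiom ⋆ □
  □∶△ : Axiom □ △

-- A product over the pair of sorts (s₁ , s₂) lives in s₂.
data ProductRule : Sort → Sort → Set where
  ⋆⋆ : ProductRule ⋆ ⋆
  □□ : ProductRule □ □
  □⋆ : ProductRule □ ⋆

-- Pseudo-terms with constants from C and n free de Bruijn variables.
data Term (C : Set) (n : ℕ) : Set where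
  var   : Fin n → Term C n
  const : C → Term C n
  sort  : Sort → Term C n
  Π     : Term C n → Term C (suc n) → Term C n
  ƛ     : Term C n → Term C (suc n) → Term C n
  _·_   : Term C n → Term C n → Term C n

infixl 9 _·_

module _ {C : Set} where

  module TermApp {T : ℕ → Set} (l : Lift T (Term C)) where
    open Lift l hiding (var)

    infixl 8 _/_

    _/_ : ∀ {m n} → Term C m → Sub T m n → Term C n
    var x   / ρ = lift (lookup ρ x)
    const c / ρ = const c
    sort s  / ρ = sort s
    Π A B   / ρ = Π (A / ρ) (B / ρ ↑)
    ƛ A b   / ρ = ƛ (A / ρ) (b / ρ ↑)
    (f · a) / ρ = (f / ρ) · (a / ρ)

  termSubst : TermSubst (Term C)
  termSubst = record { var = var; app = TermApp._/_ }

  open TermSubst termSubst public using (_/_; weaken; sub; _/Var_)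

  infixr 5 _⇒_

  _⇒_ : ∀ {n} → Term C n → Term C n → Term C n
  A ⇒ B = Π A (weaken B)

  Pow : ∀ {n} → Term C n → Term C n
  Pow X = X ⇒ sort ⋆

  T : ∀ {n} → Term C n → Term C n
  T X = Pow (Pow X)

  ⊥ : ∀ {n} → Term C n
  ⊥ = Π (sort ⋆) (var zero)

infixl 4 _▸_

data Ctx (C : Set) : ℕ → Set where
  ∅   : Ctx C zero
  _▸_ : ∀ {n} → Ctx C n → Term C n → Ctx C (suc n)

lookupCtx : ∀ {C n} → Ctx C n → Fin n → Term C n
lookupCtx (Γ ▸ A) zero    = weaken A
lookupCtx (Γ ▸ A) (suc x) = weaken (lookupCtx Γ x)

-- A rule schema lhs ≈ rhs.  The variables are the schematic ones; a premise
-- (t , A) restricts the rule to those instances in which t has type A.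
record ConversionRule (C : Set) : Set where
  field
    arity    : ℕ
    premises : List (Term C arity × Term C arity)
    lhs rhs  : Term C arity

record Extension : Set₁ where
  field
    Const  : Set
    typeOf : Const → Term Const zero
    Rule   : Set
    rule   : Rule → ConversionRule Const

module λHOL (E : Extension) where
  open Extension E
  open ConversionRule

  private
    variable
      n : ℕ
      Γ : Ctx Const n
      A A′ B B′ a a′ b b′ f f′ t u v : Term Const n
      s s′ : Sort

  infix 3 _⊢_≈_ _⊢_∶_ ⊢_

  -- Conversion relates pseudo-terms, as usual for pure type systems; the
  -- context serves only to state the typing premises of the additional rules.
  --
  -- Validity of the context is not presupposed by the typing rules, but is the
  -- separate judgement ⊢_ below.  As the formation of Π and ƛ checks the
  -- domain, every context occurring in a typing derivation that starts from a
  -- valid one, conversion subderivations aside, is valid.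
  data _⊢_≈_ : Ctx Const n → Term Const n → Term Const n → Set
  data _⊢_∶_ : Ctx Const n → Term Const n → Term Const n → Set

  data _⊢_≈_ where
    ≈-refl  : Γ ⊢ t ≈ t
    ≈-sym   : Γ ⊢ t ≈ u → Γ ⊢ u ≈ t
    ≈-trans : Γ ⊢ t ≈ u → Γ ⊢ u ≈ v → Γ ⊢ t ≈ v
    ≈-Π     : Γ ⊢ A ≈ A′ → Γ ▸ A ⊢ B ≈ B′ → Γ ⊢ Π A B ≈ Π A′ B′
    ≈-ƛ     : Γ ⊢ A ≈ A′ → Γ ▸ A ⊢ b ≈ b′ → Γ ⊢ ƛ A b ≈ ƛ A′ b′
    ≈-·     : Γ ⊢ f ≈ f′ → Γ ⊢ a ≈ a′ → Γ ⊢ f · a ≈ f′ · a′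
    ≈-β     : Γ ⊢ ƛ A b · a ≈ b / sub a
    ≈-rule  : ∀ {Γ : Ctx Const n} (r : Rule) (σ : Sub (Term Const) (arity (rule r)) n) →
              All (λ (t , A) → Γ ⊢ t / σ ∶ A / σ) (premises (rule r)) →
              Γ ⊢ lhs (rule r) / σ ≈ rhs (rule r) / σ

  data _⊢_∶_ where
    ⊢sort  : Axiom s s′ → Γ ⊢ sort s ∶ sort s′
    ⊢var   : (x : Fin n) → Γ ⊢ var x ∶ lookupCtx Γ x
    ⊢const : (c : Const) → ∅ ⊢ typeOf c ∶ sort s → Γ ⊢ const c ∶ typeOf c / []
    ⊢Π     : ProductRule s s′ →
             Γ ⊢ A ∶ sort s → Γ ▸ A ⊢ B ∶ sort s′ → Γ ⊢ Π A B ∶ sort s′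
    ⊢ƛ     : Γ ⊢ Π A B ∶ sort s → Γ ▸ A ⊢ b ∶ B → Γ ⊢ ƛ A b ∶ Π A B
    ⊢·     : Γ ⊢ f ∶ Π A B → Γ ⊢ a ∶ A → Γ ⊢ f · a ∶ B / sub a
    ⊢conv  : Γ ⊢ t ∶ A → Γ ⊢ B ∶ sort s → Γ ⊢ A ≈ B → Γ ⊢ t ∶ B

  data ⊢_ : Ctx Const n → Set where
    ⊢∅ : ⊢ ∅
    ⊢▸ : ⊢ Γ → Γ ⊢ A ∶ sort s → ⊢ Γ ▸ A

  -- match (intro u) p ≈ u (λ x : A. p (intro (match x))) for generic
  -- u : T A and p : Pow A.
  MatchIntro : Ctx Const n → (A intro match : Term Const n) → Set
  MatchIntro Γ A intro match =
    Γ ▸ T A ▸ Pow (weaken A) ⊢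
      wk² match · (wk² intro · var (suc zero)) · var zero
        ≈
      var (suc zero) ·
        ƛ (wk² A)
          (var (suc zero) · (weaken (wk² intro) · (weaken (wk² match) · var zero)))
    where
    wk² : ∀ {m} → Term Const m → Term Const (suc (suc m))
    wk² t = weaken (weaken t)

-- The conversion match (intro u) p ≈ u (λ x. p (intro (match x))) is exactly
-- what Hurkens' paradox needs.  With R x = intro (match x), put
--   Δ = λ y. (∀ p. match y p → p (R y)) → ⊥,
--   Ω = intro (λ p. ∀ x. match x p → p x).
-- Call p inductive if ∀ x. match x p → p x.  If p is inductive then so is p ∘ R,
-- which by conversion is match Ω p, whence p Ω.  Moreover Δ is inductive: if
-- match x Δ and ∀ p. match x p → p (R x), then Δ (R x), which the same hypothesis
-- at p ∘ R contradicts.  So Δ Ω; but since every inductive p ∘ R holds at Ω, also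
-- ∀ p. match Ω p → p (R Ω).
--
-- The paradox is derived in the empty context of a closed theory in which A,
-- intro and match are constants, so that every substitution in the derivation
-- computes; replacing the constants by the given terms transports it to Γ.
module Submission where

open import Data.Fin.Base using (Fin; zero; suc)
open import Data.Fin.Patterns using (0F; 1F; 2F; 3F)
open import Data.Fin.Substitution using (Lift; Sub; Subs; TermSubst; module VarSubst)
open import Data.Fin.Substitution.Lemmas using (TermLemmas; module VarLemmas)
open import Data.List.Base using (List; [])
open import Data.List.Relation.Unary.All using (All; []; _∷_)
open import Data.Nat.Base using (ℕ; zero; suc; _+_)
open import Data.Product.Base using (∃-syntax; _×_; _,_; proj₂)
open import Data.Unit.Base using (⊤; tt)
open import Data.Vec.Base using ([]; _∷_; lookup; map; tail)
open import Data.Vec.Properties using (lookup-map; map-cong; map-id; map-∘)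
open import Relation.Binary.Construct.Closure.ReflexiveTransitive using (ε; _◅_)
open import Relation.Binary.PropositionalEquality
  using (_≡_; refl; sym; trans; cong; cong₂; subst; subst₂; module ≡-Reasoning)
open import Defs

open VarLemmas using (lookup-wk)

private
  module V = VarSubst

  variable
    k l m n : ℕ

-- Substitution laws for pseudo-terms.

module _ {C : Set} where

  module _ {T′ : ℕ → Set} {lift : Lift T′ (Term C)} where
    open TermSubst.Lifted termSubst lift using (_/✶_; _↑✶_)

    const-/✶-↑✶ : ∀ k {c} (ρs : Subs T′ m n) → const c /✶ ρs ↑✶ k ≡ const c
    const-/✶-↑✶ k ε        = refl
    const-/✶-↑✶ k (ρ ◅ ρs) = cong (λ t → TermApp._/_ lift t _) (const-/✶-↑✶ k ρs)

    sort-/✶-↑✶ : ∀ k {s} (ρs : Subs T′ m n) → sort s /✶ ρs ↑✶ k ≡ sort s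
    sort-/✶-↑✶ k ε        = refl
    sort-/✶-↑✶ k (ρ ◅ ρs) = cong (λ t → TermApp._/_ lift t _) (sort-/✶-↑✶ k ρs)

    Π-/✶-↑✶ : ∀ k {A B} (ρs : Subs T′ m n) →
              Π A B /✶ ρs ↑✶ k ≡ Π (A /✶ ρs ↑✶ k) (B /✶ ρs ↑✶ suc k)
    Π-/✶-↑✶ k ε        = refl
    Π-/✶-↑✶ k (ρ ◅ ρs) = cong (λ t → TermApp._/_ lift t _) (Π-/✶-↑✶ k ρs)

    ƛ-/✶-↑✶ : ∀ k {A b} (ρs : Subs T′ m n) →
              ƛ A b /✶ ρs ↑✶ k ≡ ƛ (A /✶ ρs ↑✶ k) (b /✶ ρs ↑✶ suc k)
    ƛ-/✶-↑✶ k ε        = refl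
    ƛ-/✶-↑✶ k (ρ ◅ ρs) = cong (λ t → TermApp._/_ lift t _) (ƛ-/✶-↑✶ k ρs)

    ·-/✶-↑✶ : ∀ k {f a} (ρs : Subs T′ m n) →
              (f · a) /✶ ρs ↑✶ k ≡ (f /✶ ρs ↑✶ k) · (a /✶ ρs ↑✶ k)
    ·-/✶-↑✶ k ε        = refl
    ·-/✶-↑✶ k (ρ ◅ ρs) = cong (λ t → TermApp._/_ lift t _) (·-/✶-↑✶ k ρs)

  -- The congruences above push a sequence of substitutions through each constructor, which reduces
  -- agreement on terms to agreement on variables. The library derives its laws for weakening and
  -- single substitution from this.
  termLemmas : TermLemmas (Term C)
  termLemmas = record
    { termSubst = termSubst
    ; app-var   = refl
    ; /✶-↑✶     = /✶-↑✶
    }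
    where
    module _ {T₁ T₂ : ℕ → Set} {lift₁ : Lift T₁ (Term C)} {lift₂ : Lift T₂ (Term C)} where
      open TermSubst.Lifted termSubst lift₁ using () renaming (_↑✶_ to _↑✶₁_; _/✶_ to _/✶₁_)
      open TermSubst.Lifted termSubst lift₂ using () renaming (_↑✶_ to _↑✶₂_; _/✶_ to _/✶₂_)

      /✶-↑✶ : (ρs₁ : Subs T₁ m n) (ρs₂ : Subs T₂ m n) →
              (∀ k x → var x /✶₁ ρs₁ ↑✶₁ k ≡ var x /✶₂ ρs₂ ↑✶₂ k) →
              ∀ k (t : Term C (k + m)) → t /✶₁ ρs₁ ↑✶₁ k ≡ t /✶₂ ρs₂ ↑✶₂ k
      /✶-↑✶ ρs₁ ρs₂ hyp k (var x)   = hyp k x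
      /✶-↑✶ ρs₁ ρs₂ hyp k (const c) =
        trans (const-/✶-↑✶ k ρs₁) (sym (const-/✶-↑✶ k ρs₂))
      /✶-↑✶ ρs₁ ρs₂ hyp k (sort s)  =
        trans (sort-/✶-↑✶ k ρs₁) (sym (sort-/✶-↑✶ k ρs₂))
      /✶-↑✶ ρs₁ ρs₂ hyp k (Π A B)   =
        trans (Π-/✶-↑✶ k ρs₁)
          (trans (cong₂ Π (/✶-↑✶ ρs₁ ρs₂ hyp k A) (/✶-↑✶ ρs₁ ρs₂ hyp (suc k) B))
            (sym (Π-/✶-↑✶ k ρs₂)))
      /✶-↑✶ ρs₁ ρs₂ hyp k (ƛ A b)   =
        trans (ƛ-/✶-↑✶ k ρs₁)
          (trans (cong₂ ƛ (/✶-↑✶ ρs₁ ρs₂ hyp k A) (/✶-↑✶ ρs₁ ρs₂ hyp (suc k) b))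
            (sym (ƛ-/✶-↑✶ k ρs₂)))
      /✶-↑✶ ρs₁ ρs₂ hyp k (f · a)   =
        trans (·-/✶-↑✶ k ρs₁)
          (trans (cong₂ _·_ (/✶-↑✶ ρs₁ ρs₂ hyp k f) (/✶-↑✶ ρs₁ ρs₂ hyp k a))
            (sym (·-/✶-↑✶ k ρs₂)))

  open TermLemmas termLemmas public
    using (weaken-sub; weaken-↑; /Var≡/; ↑≡↑; ↑⋆-distrib; /-wk; lookup-id; /-⊙;
           extensionality; sub-commutes-with-renaming)

  open TermSubst (termSubst {C}) public using (_↑; _⊙_; id; wk)
  open ≡-Reasoning

  /Var-as-/ : ∀ (t : Term C m) (ρ : Sub Fin m n) → t /Var ρ ≡ t / map var ρ
  /Var-as-/ t ρ = /Var≡/ {ρ = ρ} {t = t}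

  weaken-/Var-↑ : ∀ (t : Term C m) {ρ : Sub Fin m n} →
                  weaken t /Var ρ V.↑ ≡ weaken (t /Var ρ)
  weaken-/Var-↑ t {ρ} = begin
    weaken t /Var ρ V.↑        ≡⟨ /Var-as-/ (weaken t) (ρ V.↑) ⟩
    weaken t / map var (ρ V.↑) ≡⟨ cong (weaken t /_) ↑≡↑ ⟩
    weaken t / map var ρ ↑     ≡⟨ weaken-↑ t ⟩
    weaken (t / map var ρ)     ≡⟨ cong weaken (/Var-as-/ t ρ) ⟨
    weaken (t /Var ρ)          ∎

  /-/Var : ∀ (t : Term C l) {σ : Sub (Term C) l m} {ρ : Sub Fin m n} →
           t / σ /Var ρ ≡ t / map (_/Var ρ) σ
  /-/Var t {σ} {ρ} = begin
    t / σ /Var ρ         ≡⟨ /Var-as-/ (t / σ) ρ ⟩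
    t / σ / map var ρ    ≡⟨ /-⊙ t ⟨
    t / (σ ⊙ map var ρ)  ≡⟨ cong (t /_) (map-cong (λ u → /Var-as-/ u ρ) σ) ⟨
    t / map (_/Var ρ) σ  ∎

-- Weakening of conversion and typing derivations.

module Renaming (E : Extension) where
  open Extension E
  open ConversionRule
  open λHOL E

  private
    variable
      Γ Δ : Ctx Const n
      ρ   : Sub Fin m n
      A t u : Term Const n

  ≡⇒≈ : t ≡ u → Γ ⊢ t ≈ u
  ≡⇒≈ refl = ≈-refl

  -- The types agree syntactically, so that the variable case involves no conversion.
  Renames : Sub Fin m n → Ctx Const m → Ctx Const n → Set
  Renames ρ Γ Δ = ∀ x → lookupCtx Δ (lookup ρ x) ≡ lookupCtx Γ x /Var ρ

  renames-↑ : Renames ρ Γ Δ → Renames (ρ V.↑) (Γ ▸ A) (Δ ▸ A /Var ρ)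
  renames-↑ {A = A} r zero = sym (weaken-/Var-↑ A)
  renames-↑ {ρ = ρ} {Γ = Γ} {Δ = Δ} {A = A} r (suc x) = begin
    lookupCtx (Δ ▸ A /Var ρ) (lookup (map suc ρ) x)
      ≡⟨ cong (lookupCtx (Δ ▸ A /Var ρ)) (lookup-map x suc ρ) ⟩
    weaken (lookupCtx Δ (lookup ρ x))                ≡⟨ cong weaken (r x) ⟩
    weaken (lookupCtx Γ x /Var ρ)                    ≡⟨ weaken-/Var-↑ (lookupCtx Γ x) ⟨
    weaken (lookupCtx Γ x) /Var ρ V.↑                ∎
    where open ≡-Reasoning

  -- Mutual with typing, because instances of the additional rules carry typing premises. A renamed
  -- instance is an instance of the same rule, with the renaming composed into its substitution.
  rename-≈ : Renames ρ Γ Δ → Γ ⊢ t ≈ u → Δ ⊢ t /Var ρ ≈ u /Var ρ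
  rename-⊢ : Renames ρ Γ Δ → Γ ⊢ t ∶ A → Δ ⊢ t /Var ρ ∶ A /Var ρ
  rename-All : ∀ {ps : List (Term Const l × Term Const l)} {σ : Sub (Term Const) l m} →
               Renames ρ Γ Δ →
               All (λ (t , A) → Γ ⊢ t / σ ∶ A / σ) ps →
               All (λ (t , A) → Δ ⊢ t / map (_/Var ρ) σ ∶ A / map (_/Var ρ) σ) ps

  rename-≈ r ≈-refl          = ≈-refl
  rename-≈ r (≈-sym e)       = ≈-sym (rename-≈ r e)
  rename-≈ r (≈-trans e e′)  = ≈-trans (rename-≈ r e) (rename-≈ r e′)
  rename-≈ r (≈-Π e e′)      = ≈-Π (rename-≈ r e) (rename-≈ (renames-↑ r) e′)
  rename-≈ r (≈-ƛ e e′)      = ≈-ƛ (rename-≈ r e) (rename-≈ (renames-↑ r) e′)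
  rename-≈ r (≈-· e e′)      = ≈-· (rename-≈ r e) (rename-≈ r e′)
  rename-≈ r (≈-β {b = b})   =
    ≈-trans ≈-β (≡⇒≈ (sym (sub-commutes-with-renaming {t = b})))
  rename-≈ r (≈-rule R σ ps) =
    subst₂ (_ ⊢_≈_) (sym (/-/Var (lhs (rule R)))) (sym (/-/Var (rhs (rule R))))
      (≈-rule R _ (rename-All r ps))

  rename-⊢ r (⊢sort a)           = ⊢sort a
  rename-⊢ r (⊢var x)            = subst (_ ⊢ _ ∶_) (r x) (⊢var _)
  rename-⊢ r (⊢const c ⊢c)       =
    subst (_ ⊢ _ ∶_) (sym (/-/Var (typeOf c))) (⊢const c ⊢c)
  rename-⊢ r (⊢Π R ⊢A ⊢B)        = ⊢Π R (rename-⊢ r ⊢A) (rename-⊢ (renames-↑ r) ⊢B)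
  rename-⊢ r (⊢ƛ ⊢ΠAB ⊢b)        = ⊢ƛ (rename-⊢ r ⊢ΠAB) (rename-⊢ (renames-↑ r) ⊢b)
  rename-⊢ r (⊢· {B = B} ⊢f ⊢a)  =
    subst (_ ⊢ _ ∶_) (sym (sub-commutes-with-renaming {t = B}))
      (⊢· (rename-⊢ r ⊢f) (rename-⊢ r ⊢a))
  rename-⊢ r (⊢conv ⊢t ⊢B e)     = ⊢conv (rename-⊢ r ⊢t) (rename-⊢ r ⊢B) (rename-≈ r e)

  rename-All r []                      = []
  rename-All r (_∷_ {x = t , A} ⊢t ps) =
    subst₂ (_ ⊢_∶_) (/-/Var t) (/-/Var A) (rename-⊢ r ⊢t) ∷ rename-All r ps

  renames-wk : Renames V.wk Γ (Γ ▸ A)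
  renames-wk {Γ = Γ} {A = A} x = cong (lookupCtx (Γ ▸ A)) (lookup-wk x)

  weaken-≈ : Γ ⊢ t ≈ u → Γ ▸ A ⊢ weaken t ≈ weaken u
  weaken-≈ = rename-≈ renames-wk

  weaken-⊢ : ∀ {B} → Γ ⊢ t ∶ A → Γ ▸ B ⊢ weaken t ∶ weaken A
  weaken-⊢ = rename-⊢ renames-wk

-- The closed theory of a paradoxical type.

pattern 𝐀      = const 0F
pattern 𝐢𝐧𝐭𝐫𝐨 = const 1F
pattern 𝐦𝐚𝐭𝐜𝐡 = const 2F

Tm : ℕ → Set
Tm = Term (Fin 3)

constType : Fin 3 → Tm 0
constType 0F = sort □
constType 1F = T 𝐀 ⇒ 𝐀
constType 2F = 𝐀 ⇒ T 𝐀

-- Both sides abstracted over u and p, so that instances arise by β alone and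
-- the rule can be weakened without touching the context of u and p.
matchIntroˡ matchIntroʳ : Tm n
matchIntroˡ = ƛ (T 𝐀) (ƛ (Pow 𝐀) (𝐦𝐚𝐭𝐜𝐡 · (𝐢𝐧𝐭𝐫𝐨 · var 1F) · var 0F))
matchIntroʳ = ƛ (T 𝐀) (ƛ (Pow 𝐀) (var 1F · ƛ 𝐀 (var 1F · (𝐢𝐧𝐭𝐫𝐨 · (𝐦𝐚𝐭𝐜𝐡 · var 0F)))))

Paradoxical : Extension
Paradoxical = record
  { Const  = Fin 3
  ; typeOf = constType
  ; Rule   = ⊤
  ; rule   = λ _ → record
    { arity = 0 ; premises = [] ; lhs = matchIntroˡ ; rhs = matchIntroʳ }
  }

-- Hurkens' paradox in the closed theory.

module Hurkens where
  open λHOL Paradoxical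
  open Renaming Paradoxical using (≡⇒≈; weaken-⊢)

  private
    variable
      Γ : Ctx (Fin 3) n
      p u x A B : Tm n

  infixl 10 _∘R

  R : Tm n → Tm n
  R x = 𝐢𝐧𝐭𝐫𝐨 · (𝐦𝐚𝐭𝐜𝐡 · x)

  _∘R : Tm n → Tm n
  p ∘R = ƛ 𝐀 (weaken p · R (var 0F))

  Ind : Tm n → Tm n
  Ind p = Π 𝐀 (𝐦𝐚𝐭𝐜𝐡 · var 0F · weaken p ⇒ weaken p · var 0F)

  Stable : Tm n → Tm n
  Stable x = Π (Pow 𝐀) (𝐦𝐚𝐭𝐜𝐡 · weaken x · var 0F ⇒ var 0F · R (weaken x))

  Δ : Tm n
  Δ = ƛ 𝐀 (Stable (var 0F) ⇒ ⊥)

  Ω : Tm n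
  Ω = 𝐢𝐧𝐭𝐫𝐨 · ƛ (Pow 𝐀) (Ind (var 0F))

  -- Expand to `matchIntroˡ · u · p`, rewrite the head by the rule, and contract. Contraction leaves
  -- `weaken u / sub p`, which `weaken-sub` turns back into `u`.
  match-intro : Γ ⊢ 𝐦𝐚𝐭𝐜𝐡 · (𝐢𝐧𝐭𝐫𝐨 · u) · p ≈ u · p ∘R
  match-intro {u = u} {p = p} =
    ≈-trans
      (≈-sym (β₂ (cong (λ v → 𝐦𝐚𝐭𝐜𝐡 · (𝐢𝐧𝐭𝐫𝐨 · v) · p) (weaken-sub u {p}))))
      (≈-trans
        (≈-· (≈-· (≈-rule tt [] []) ≈-refl) ≈-refl)
        (β₂ (cong (λ v → v · p ∘R) (weaken-sub u {p}))))
    where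
    β₂ : ∀ {b v} → b / sub u ↑ / sub p ≡ v → Γ ⊢ ƛ A (ƛ B b) · u · p ≈ v
    β₂ eq = ≈-trans (≈-· ≈-β ≈-refl) (≈-trans ≈-β (≡⇒≈ eq))

  match-Ω : Γ ⊢ 𝐦𝐚𝐭𝐜𝐡 · Ω · p ≈ Ind (p ∘R)
  match-Ω = ≈-trans match-intro ≈-β

  ⊢𝐀 : Γ ⊢ 𝐀 ∶ sort □
  ⊢𝐀 = ⊢const 0F (⊢sort □∶△)

  ⊢⋆ : Γ ⊢ sort ⋆ ∶ sort □
  ⊢⋆ = ⊢sort ⋆∶□

  ⊢Pow𝐀 : Γ ⊢ Pow 𝐀 ∶ sort □
  ⊢Pow𝐀 = ⊢Π □□ ⊢𝐀 ⊢⋆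

  ⊢T𝐀 : Γ ⊢ T 𝐀 ∶ sort □
  ⊢T𝐀 = ⊢Π □□ ⊢Pow𝐀 ⊢⋆

  ⊢intro : Γ ⊢ u ∶ T 𝐀 → Γ ⊢ 𝐢𝐧𝐭𝐫𝐨 · u ∶ 𝐀
  ⊢intro = ⊢· (⊢const 1F (⊢Π □□ ⊢T𝐀 ⊢𝐀))

  ⊢match : Γ ⊢ x ∶ 𝐀 → Γ ⊢ 𝐦𝐚𝐭𝐜𝐡 · x ∶ T 𝐀
  ⊢match = ⊢· (⊢const 2F (⊢Π □□ ⊢𝐀 ⊢T𝐀))

  ⊢R : Γ ⊢ x ∶ 𝐀 → Γ ⊢ R x ∶ 𝐀
  ⊢R ⊢x = ⊢intro (⊢match ⊢x)

  ⊢⊥ : Γ ⊢ ⊥ ∶ sort ⋆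
  ⊢⊥ = ⊢Π □⋆ ⊢⋆ (⊢var 0F)

  ⊢⇒ : Γ ⊢ A ∶ sort ⋆ → Γ ⊢ B ∶ sort ⋆ → Γ ⊢ A ⇒ B ∶ sort ⋆
  ⊢⇒ ⊢A ⊢B = ⊢Π ⋆⋆ ⊢A (weaken-⊢ ⊢B)

  ⊢∘R : Γ ⊢ p ∶ Pow 𝐀 → Γ ⊢ p ∘R ∶ Pow 𝐀
  ⊢∘R ⊢p = ⊢ƛ ⊢Pow𝐀 (⊢· (weaken-⊢ ⊢p) (⊢R (⊢var 0F)))

  ⊢Ind : Γ ⊢ p ∶ Pow 𝐀 → Γ ⊢ Ind p ∶ sort ⋆
  ⊢Ind ⊢p = ⊢Π □⋆ ⊢𝐀
    (⊢⇒ (⊢· (⊢match (⊢var 0F)) (weaken-⊢ ⊢p)) (⊢· (weaken-⊢ ⊢p) (⊢var 0F)))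

  ⊢Stable : Γ ⊢ x ∶ 𝐀 → Γ ⊢ Stable x ∶ sort ⋆
  ⊢Stable ⊢x = ⊢Π □⋆ ⊢Pow𝐀
    (⊢⇒ (⊢· (⊢match (weaken-⊢ ⊢x)) (⊢var 0F))
        (⊢· (⊢var 0F) (⊢R (weaken-⊢ ⊢x))))

  ⊢Δ : Γ ⊢ Δ ∶ Pow 𝐀
  ⊢Δ = ⊢ƛ ⊢Pow𝐀 (⊢⇒ (⊢Stable (⊢var 0F)) ⊢⊥)

  ⊢Ω : Γ ⊢ Ω ∶ 𝐀
  ⊢Ω = ⊢intro (⊢ƛ ⊢T𝐀 (⊢Ind (⊢var 0F)))

  -- The paradox applies this both to `Δ` and to each `p ∘R`. It is a context variable until
  -- `paradox` discharges it, so its proof enters the final term once.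
  inductive⇒Ω : Tm 0
  inductive⇒Ω = Π (Pow 𝐀) (Ind (var 0F) ⇒ var 0F · Ω)

  ⊢inductive⇒Ω : ∅ ⊢ inductive⇒Ω ∶ sort ⋆
  ⊢inductive⇒Ω = ⊢Π □⋆ ⊢Pow𝐀 (⊢⇒ (⊢Ind (⊢var 0F)) (⊢· (⊢var 0F) ⊢Ω))

  -- The derivation determines the witness, here `λ p h. h Ω (λ x. h (R x))`.
  inductive-Ω : ∃[ t ] ∅ ⊢ t ∶ inductive⇒Ω
  inductive-Ω = _ , ⊢ƛ ⊢inductive⇒Ω (⊢ƛ (⊢⇒ (⊢Ind (⊢var 0F)) (⊢· (⊢var 0F) ⊢Ω))
    (⊢· (⊢· (⊢var 0F) ⊢Ω)
      (⊢conv (⊢ƛ ⊢B₁ (⊢· (⊢var 1F) (⊢R (⊢var 0F)))) (⊢· (⊢match ⊢Ω) (⊢var 1F)) B₁≈)))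
    where
    -- The type of `λ x. h (R x)` before conversion. It becomes `Ind (p ∘R)` by reading
    -- `match (R x) p` as `match x (p ∘R)` and expanding `p (R x)` to `(p ∘R) x`.
    B₁ : Tm 2
    B₁ = Π 𝐀 (𝐦𝐚𝐭𝐜𝐡 · R (var 0F) · var 2F ⇒ var 2F · R (var 0F))
    ⊢B₁ : ∅ ▸ Pow 𝐀 ▸ Ind (var 0F) ⊢ B₁ ∶ sort ⋆
    ⊢B₁ = ⊢Π □⋆ ⊢𝐀 (⊢⇒ (⊢· (⊢match (⊢R (⊢var 0F))) (⊢var 2F)) (⊢· (⊢var 2F) (⊢R (⊢var 0F))))
    B₁≈ : ∅ ▸ Pow 𝐀 ▸ Ind (var 0F) ⊢ B₁ ≈ 𝐦𝐚𝐭𝐜𝐡 · Ω · var 1F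
    B₁≈ = ≈-trans (≈-Π ≈-refl (≈-Π match-intro (≈-sym ≈-β))) (≈-sym match-Ω)

  -- The term is `λ x a s. s Δ a (λ p. s (p ∘R))`, with `a : match x Δ` and `s : Stable x`. Here
  -- `s Δ a` proves `Δ (R x)`, that is `Stable (R x) → ⊥`, and `λ p. s (p ∘R)` proves `Stable (R x)`
  -- up to conversion.
  Δ-inductive : ∃[ t ] ∅ ▸ inductive⇒Ω ⊢ t ∶ Ind Δ
  Δ-inductive = _ , ⊢conv
    (⊢ƛ (⊢Π □⋆ ⊢𝐀 (⊢⇒ ⊢mxΔ (⊢⇒ (⊢Stable (⊢var 0F)) ⊢⊥)))
      (⊢ƛ (⊢⇒ ⊢mxΔ (⊢⇒ (⊢Stable (⊢var 0F)) ⊢⊥)) (⊢ƛ (⊢⇒ (⊢Stable (⊢var 1F)) ⊢⊥)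
        (⊢· (⊢conv (⊢· (⊢· (⊢var 0F) ⊢Δ) (⊢var 1F)) (⊢⇒ (⊢Stable (⊢R (⊢var 2F))) ⊢⊥) ≈-β)
          (⊢ƛ (⊢Stable (⊢R (⊢var 2F)))
            (⊢conv (⊢· (⊢var 1F) (⊢∘R (⊢var 0F)))
              (⊢⇒ (⊢· (⊢match (⊢R (⊢var 3F))) (⊢var 0F)) (⊢· (⊢var 0F) (⊢R (⊢R (⊢var 3F)))))
              (≈-Π (≈-sym match-intro) ≈-β)))))))
    (⊢Ind ⊢Δ)
    (≈-Π ≈-refl (≈-Π ≈-refl (≈-sym ≈-β)))
    where
    ⊢mxΔ : ∅ ▸ inductive⇒Ω ▸ 𝐀 ⊢ 𝐦𝐚𝐭𝐜𝐡 · var 0F · Δ ∶ sort ⋆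
    ⊢mxΔ = ⊢· (⊢match (⊢var 0F)) ⊢Δ

  -- The hypothesis at `p ∘R` is already the required implication: `Ind (p ∘R)` converts to
  -- `match Ω p`, and `(p ∘R) Ω` to `p (R Ω)`.
  Ω-stable : ∃[ t ] ∅ ▸ inductive⇒Ω ⊢ t ∶ Stable Ω
  Ω-stable = _ , ⊢ƛ (⊢Stable ⊢Ω)
    (⊢conv (⊢· (⊢var 1F) (⊢∘R (⊢var 0F)))
      (⊢⇒ (⊢· (⊢match ⊢Ω) (⊢var 0F)) (⊢· (⊢var 0F) (⊢R ⊢Ω)))
      (≈-Π (≈-sym match-Ω) ≈-β))

  paradox : ∃[ t ] ∅ ⊢ t ∶ ⊥
  paradox = _ , ⊢· (⊢ƛ (⊢⇒ ⊢inductive⇒Ω ⊢⊥)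
    (⊢· (⊢conv (⊢· (⊢· (⊢var 0F) ⊢Δ) (proj₂ Δ-inductive)) (⊢⇒ (⊢Stable ⊢Ω) ⊢⊥) ≈-β)
      (proj₂ Ω-stable)))
    (proj₂ inductive-Ω)

-- Interpretation of constants by terms.

module _ {C : Set} {l : ℕ} where

  open ≡-Reasoning

  -- Simultaneous substitution for variables and constants. With `η = []` a closed term lands in a
  -- context of any length.
  ⟦_⟧ : Term (Fin l) m → Sub (Term C) m n → Sub (Term C) l n → Term C n
  ⟦ var x   ⟧ η ι = lookup η x
  ⟦ const c ⟧ η ι = lookup ι c
  ⟦ sort s  ⟧ η ι = sort s
  ⟦ Π A B   ⟧ η ι = Π (⟦ A ⟧ η ι) (⟦ B ⟧ (η ↑) (map weaken ι))
  ⟦ ƛ A b   ⟧ η ι = ƛ (⟦ A ⟧ η ι) (⟦ b ⟧ (η ↑) (map weaken ι))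
  ⟦ f · a   ⟧ η ι = ⟦ f ⟧ η ι · ⟦ a ⟧ η ι

  ⟦⟧-/ : ∀ (t : Term (Fin l) k) (η : Sub (Term C) k m) (ι : Sub (Term C) l m)
         (σ : Sub (Term C) m n) → ⟦ t ⟧ η ι / σ ≡ ⟦ t ⟧ (η ⊙ σ) (ι ⊙ σ)
  ⟦⟧-/-↑ : ∀ (t : Term (Fin l) (suc k)) (η : Sub (Term C) k m) (ι : Sub (Term C) l m)
           (σ : Sub (Term C) m n) →
           ⟦ t ⟧ (η ↑) (map weaken ι) / σ ↑ ≡ ⟦ t ⟧ ((η ⊙ σ) ↑) (map weaken (ι ⊙ σ))

  ⟦⟧-/ (var x)   η ι σ = sym (lookup-map x _ η)
  ⟦⟧-/ (const c) η ι σ = sym (lookup-map c _ ι)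
  ⟦⟧-/ (sort s)  η ι σ = refl
  ⟦⟧-/ (Π A B)   η ι σ = cong₂ Π (⟦⟧-/ A η ι σ) (⟦⟧-/-↑ B η ι σ)
  ⟦⟧-/ (ƛ A b)   η ι σ = cong₂ ƛ (⟦⟧-/ A η ι σ) (⟦⟧-/-↑ b η ι σ)
  ⟦⟧-/ (f · a)   η ι σ = cong₂ _·_ (⟦⟧-/ f η ι σ) (⟦⟧-/ a η ι σ)

  ⟦⟧-/-↑ t η ι σ = begin
    ⟦ t ⟧ (η ↑) (map weaken ι) / σ ↑
      ≡⟨ ⟦⟧-/ t (η ↑) (map weaken ι) (σ ↑) ⟩
    ⟦ t ⟧ (η ↑ ⊙ σ ↑) (map weaken ι ⊙ σ ↑)
      -- `map weaken ι` is the tail of `ι ↑`, so distributivity of lifting serves the constants too.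
      ≡⟨ cong₂ ⟦ t ⟧ (↑⋆-distrib {ρ₁ = η} 1) (cong tail (↑⋆-distrib {ρ₁ = ι} 1)) ⟨
    ⟦ t ⟧ ((η ⊙ σ) ↑) (map weaken (ι ⊙ σ))
      ∎

  weaken-⟦⟧ : ∀ (t : Term (Fin l) m) (η : Sub (Term C) m n) ι →
              weaken (⟦ t ⟧ η ι) ≡ ⟦ t ⟧ (map weaken η) (map weaken ι)
  weaken-⟦⟧ t η ι = begin
    weaken (⟦ t ⟧ η ι)                   ≡⟨ /-wk {t = ⟦ t ⟧ η ι} ⟨
    ⟦ t ⟧ η ι / wk                       ≡⟨ ⟦⟧-/ t η ι wk ⟩
    ⟦ t ⟧ (η ⊙ wk) (ι ⊙ wk)              ≡⟨ cong₂ ⟦ t ⟧ (⊙-wk η) (⊙-wk ι) ⟩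
    ⟦ t ⟧ (map weaken η) (map weaken ι)  ∎
    where
    ⊙-wk : ∀ {k} (ρ : Sub (Term C) k _) → ρ ⊙ wk ≡ map weaken ρ
    ⊙-wk = map-cong (λ u → /-wk {t = u})

  -- Renamings precede general substitutions because `⟦/⟧` passes a binder by weakening the
  -- substituted terms.
  ⟦/Var⟧ : ∀ (t : Term (Fin l) k) (ρ : Sub Fin k m) (η : Sub (Term C) m n) ι →
           ⟦ t /Var ρ ⟧ η ι ≡ ⟦ t ⟧ (map (lookup η) ρ) ι
  ⟦/Var-↑⟧ : ∀ (t : Term (Fin l) (suc k)) (ρ : Sub Fin k m) (η : Sub (Term C) m n) ι →
             ⟦ t /Var ρ V.↑ ⟧ (η ↑) ι ≡ ⟦ t ⟧ (map (lookup η) ρ ↑) ι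

  ⟦/Var⟧ (var x)   ρ η ι = sym (lookup-map x _ ρ)
  ⟦/Var⟧ (const c) ρ η ι = refl
  ⟦/Var⟧ (sort s)  ρ η ι = refl
  ⟦/Var⟧ (Π A B)   ρ η ι = cong₂ Π (⟦/Var⟧ A ρ η ι) (⟦/Var-↑⟧ B ρ η (map weaken ι))
  ⟦/Var⟧ (ƛ A b)   ρ η ι = cong₂ ƛ (⟦/Var⟧ A ρ η ι) (⟦/Var-↑⟧ b ρ η (map weaken ι))
  ⟦/Var⟧ (f · a)   ρ η ι = cong₂ _·_ (⟦/Var⟧ f ρ η ι) (⟦/Var⟧ a ρ η ι)

  ⟦/Var-↑⟧ t ρ η ι = begin
    ⟦ t /Var ρ V.↑ ⟧ (η ↑) ι               ≡⟨ ⟦/Var⟧ t (ρ V.↑) (η ↑) ι ⟩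
    ⟦ t ⟧ (map (lookup (η ↑)) (ρ V.↑)) ι   ≡⟨ cong (λ ζ → ⟦ t ⟧ (var zero ∷ ζ) ι) lookup-↑ ⟩
    ⟦ t ⟧ (map (lookup η) ρ ↑) ι           ∎
    where
    lookup-↑ : map (lookup (η ↑)) (map suc ρ) ≡ map weaken (map (lookup η) ρ)
    lookup-↑ = begin
      map (lookup (η ↑)) (map suc ρ)       ≡⟨ map-∘ _ _ ρ ⟨
      map (lookup (map weaken η)) ρ        ≡⟨ map-cong (λ x → lookup-map x weaken η) ρ ⟩
      map (λ x → weaken (lookup η x)) ρ    ≡⟨ map-∘ _ _ ρ ⟩
      map weaken (map (lookup η) ρ)        ∎

  ⟦weaken⟧ : ∀ (t : Term (Fin l) m) u (η : Sub (Term C) m n) ι →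
             ⟦ weaken t ⟧ (u ∷ η) ι ≡ ⟦ t ⟧ η ι
  ⟦weaken⟧ t u η ι = begin
    ⟦ weaken t ⟧ (u ∷ η) ι                ≡⟨ ⟦/Var⟧ t V.wk (u ∷ η) ι ⟩
    ⟦ t ⟧ (map (lookup (u ∷ η)) V.wk) ι   ≡⟨ cong (λ ζ → ⟦ t ⟧ ζ ι) lookup∘wk ⟩
    ⟦ t ⟧ η ι                             ∎
    where
    lookup∘wk : map (lookup (u ∷ η)) V.wk ≡ η
    lookup∘wk = extensionality λ x →
      trans (lookup-map x _ V.wk) (cong (lookup (u ∷ η)) (lookup-wk x))

  ⟦weaken⟧-↑ : ∀ (t : Term (Fin l) m) (η : Sub (Term C) m n) ι →
               ⟦ weaken t ⟧ (η ↑) (map weaken ι) ≡ weaken (⟦ t ⟧ η ι)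
  ⟦weaken⟧-↑ t η ι =
    trans (⟦weaken⟧ t (var zero) (map weaken η) (map weaken ι)) (sym (weaken-⟦⟧ t η ι))

  ⟦/⟧ : ∀ (t : Term (Fin l) k) (σ : Sub (Term (Fin l)) k m) (η : Sub (Term C) m n) ι →
        ⟦ t / σ ⟧ η ι ≡ ⟦ t ⟧ (map (λ u → ⟦ u ⟧ η ι) σ) ι
  ⟦/-↑⟧ : ∀ (t : Term (Fin l) (suc k)) (σ : Sub (Term (Fin l)) k m) (η : Sub (Term C) m n) ι →
          ⟦ t / σ ↑ ⟧ (η ↑) (map weaken ι) ≡
          ⟦ t ⟧ (map (λ u → ⟦ u ⟧ η ι) σ ↑) (map weaken ι)

  ⟦/⟧ (var x)   σ η ι = sym (lookup-map x _ σ)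
  ⟦/⟧ (const c) σ η ι = refl
  ⟦/⟧ (sort s)  σ η ι = refl
  ⟦/⟧ (Π A B)   σ η ι = cong₂ Π (⟦/⟧ A σ η ι) (⟦/-↑⟧ B σ η ι)
  ⟦/⟧ (ƛ A b)   σ η ι = cong₂ ƛ (⟦/⟧ A σ η ι) (⟦/-↑⟧ b σ η ι)
  ⟦/⟧ (f · a)   σ η ι = cong₂ _·_ (⟦/⟧ f σ η ι) (⟦/⟧ a σ η ι)

  ⟦/-↑⟧ t σ η ι =
    trans (⟦/⟧ t _ (η ↑) (map weaken ι))
      (cong (λ ζ → ⟦ t ⟧ (var zero ∷ ζ) (map weaken ι)) (begin
        map (λ u → ⟦ u ⟧ (η ↑) (map weaken ι)) (map weaken σ)
          ≡⟨ map-∘ _ _ σ ⟨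
        map (λ u → ⟦ weaken u ⟧ (η ↑) (map weaken ι)) σ
          ≡⟨ map-cong (λ u → ⟦weaken⟧-↑ u η ι) σ ⟩
        map (λ u → weaken (⟦ u ⟧ η ι)) σ
          ≡⟨ map-∘ _ _ σ ⟩
        map weaken (map (λ u → ⟦ u ⟧ η ι) σ)
          ∎))

  map-weaken-⊙-sub : ∀ (ρ : Sub (Term C) m n) {a} → map weaken ρ ⊙ sub a ≡ ρ
  map-weaken-⊙-sub ρ {a} = begin
    map (_/ sub a) (map weaken ρ)      ≡⟨ map-∘ _ _ ρ ⟨
    map (λ t → weaken t / sub a) ρ     ≡⟨ map-cong (λ t → weaken-sub t) ρ ⟩
    map (λ t → t) ρ                    ≡⟨ map-id ρ ⟩
    ρ                                  ∎

  -- Both sides equal `⟦ b ⟧ (⟦ a ⟧ η ι ∷ η) ι`; on the right, the substitution cancels the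
  -- weakenings of `η` and `ι`.
  ⟦/sub⟧ : ∀ (b : Term (Fin l) (suc m)) a (η : Sub (Term C) m n) ι →
           ⟦ b / sub a ⟧ η ι ≡ ⟦ b ⟧ (η ↑) (map weaken ι) / sub (⟦ a ⟧ η ι)
  ⟦/sub⟧ b a η ι = begin
    ⟦ b / sub a ⟧ η ι
      ≡⟨ ⟦/⟧ b (sub a) η ι ⟩
    ⟦ b ⟧ (a′ ∷ map (λ u → ⟦ u ⟧ η ι) id) ι
      ≡⟨ cong (λ ζ → ⟦ b ⟧ (a′ ∷ ζ) ι) ⟦id⟧ ⟩
    ⟦ b ⟧ (a′ ∷ η) ι
      ≡⟨ cong₂ (λ ζ κ → ⟦ b ⟧ (a′ ∷ ζ) κ) (map-weaken-⊙-sub η) (map-weaken-⊙-sub ι) ⟨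
    ⟦ b ⟧ (η ↑ ⊙ sub a′) (map weaken ι ⊙ sub a′)
      ≡⟨ ⟦⟧-/ b (η ↑) (map weaken ι) (sub a′) ⟨
    ⟦ b ⟧ (η ↑) (map weaken ι) / sub a′
      ∎
    where
    a′ = ⟦ a ⟧ η ι
    ⟦id⟧ : map (λ u → ⟦ u ⟧ η ι) id ≡ η
    ⟦id⟧ = extensionality λ x →
      trans (lookup-map x _ id) (cong (λ u → ⟦ u ⟧ η ι) (lookup-id x))

-- Soundness of the interpretation, and transport of the paradox.

module Soundness (E : Extension) where
  open Extension E using (Const)
  open λHOL E
  open λHOL Paradoxical using () renaming (_⊢_≈_ to _⊢₀_≈_; _⊢_∶_ to _⊢₀_∶_)
  open Renaming E

  private
    variable
      Γ : Ctx (Fin 3) m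
      Δ : Ctx Const n
      η : Sub (Term Const) m n
      ι : Sub (Term Const) 3 n
      t u A : Tm m

  record Models (Δ : Ctx Const n) (ι : Sub (Term Const) 3 n) : Set where
    field
      constants  : ∀ c → Δ ⊢ lookup ι c ∶ ⟦ constType c ⟧ [] ι
      conversion : Δ ⊢ ⟦ matchIntroˡ ⟧ [] ι ≈ ⟦ matchIntroʳ ⟧ [] ι

  open Models

  -- Both fields interpret closed terms, on which weakening acts through `ι` alone.
  models-weaken : ∀ {B} → Models Δ ι → Models (Δ ▸ B) (map weaken ι)
  models-weaken {ι = ι} M .constants c =
    subst₂ (_ ⊢_∶_) (sym (lookup-map c weaken ι)) (weaken-⟦⟧ (constType c) [] ι)
      (weaken-⊢ (M .constants c))
  models-weaken {Δ = Δ} {ι = ι} {B = B} M .conversion =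
    subst₂ (Δ ▸ B ⊢_≈_) (weaken-⟦⟧ matchIntroˡ [] ι) (weaken-⟦⟧ matchIntroʳ [] ι)
      (weaken-≈ (M .conversion))

  sound-≈ : Models Δ ι → Γ ⊢₀ t ≈ u → Δ ⊢ ⟦ t ⟧ η ι ≈ ⟦ u ⟧ η ι
  sound-≈ M ≈-refl           = ≈-refl
  sound-≈ M (≈-sym e)        = ≈-sym (sound-≈ M e)
  sound-≈ M (≈-trans e e′)   = ≈-trans (sound-≈ M e) (sound-≈ M e′)
  sound-≈ M (≈-Π e e′)       = ≈-Π (sound-≈ M e) (sound-≈ (models-weaken M) e′)
  sound-≈ M (≈-ƛ e e′)       = ≈-ƛ (sound-≈ M e) (sound-≈ (models-weaken M) e′)
  sound-≈ M (≈-· e e′)       = ≈-· (sound-≈ M e) (sound-≈ M e′)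
  sound-≈ M (≈-β {b = b})    = ≈-trans ≈-β (≡⇒≈ (sym (⟦/sub⟧ b _ _ _)))
  -- Both sides of the rule are closed, so their interpretations under `η` and `[]` agree by
  -- computation.
  sound-≈ M (≈-rule tt [] _) = M .conversion

  Realises : Sub (Term Const) m n → Sub (Term Const) 3 n →
             Ctx (Fin 3) m → Ctx Const n → Set
  Realises η ι Γ Δ = ∀ x → Δ ⊢ lookup η x ∶ ⟦ lookupCtx Γ x ⟧ η ι

  realises-↑ : Realises η ι Γ Δ →
               Realises (η ↑) (map weaken ι) (Γ ▸ A) (Δ ▸ ⟦ A ⟧ η ι)
  realises-↑ {η = η} {ι = ι} {Δ = Δ} {A = A} r zero =
    subst (Δ ▸ ⟦ A ⟧ η ι ⊢ var zero ∶_) (sym (⟦weaken⟧-↑ A η ι)) (⊢var zero)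
  realises-↑ {η = η} {ι = ι} {Γ = Γ} r (suc x) =
    subst₂ (_ ⊢_∶_) (sym (lookup-map x weaken η)) (sym (⟦weaken⟧-↑ (lookupCtx Γ x) η ι))
      (weaken-⊢ (r x))

  sound-⊢ : Models Δ ι → Realises η ι Γ Δ → Γ ⊢₀ t ∶ A → Δ ⊢ ⟦ t ⟧ η ι ∶ ⟦ A ⟧ η ι
  sound-⊢ M r (⊢sort a)          = ⊢sort a
  sound-⊢ M r (⊢var x)           = r x
  sound-⊢ M r (⊢const c _)       =
    subst (_ ⊢ _ ∶_) (sym (⟦/⟧ (constType c) [] _ _)) (M .constants c)
  sound-⊢ M r (⊢Π R ⊢A ⊢B)       =
    ⊢Π R (sound-⊢ M r ⊢A) (sound-⊢ (models-weaken M) (realises-↑ r) ⊢B)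
  sound-⊢ M r (⊢ƛ ⊢ΠAB ⊢b)       =
    ⊢ƛ (sound-⊢ M r ⊢ΠAB) (sound-⊢ (models-weaken M) (realises-↑ r) ⊢b)
  sound-⊢ M r (⊢· {B = B} ⊢f ⊢a) =
    subst (_ ⊢ _ ∶_) (sym (⟦/sub⟧ B _ _ _)) (⊢· (sound-⊢ M r ⊢f) (sound-⊢ M r ⊢a))
  sound-⊢ M r (⊢conv ⊢t ⊢B e)    = ⊢conv (sound-⊢ M r ⊢t) (sound-⊢ M r ⊢B) (sound-≈ M e)

theorem2 : (E : Extension) → let open Extension E using (Const) in let open λHOL E in
    ∀ {n : ℕ} (Γ : Ctx Const n) (A intro match : Term Const n) →
    ⊢ Γ →
    Γ ⊢ A ∶ sort □ →
    Γ ⊢ intro ∶ T A ⇒ A →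
    Γ ⊢ match ∶ A ⇒ T A →
    MatchIntro Γ A intro match →
    ∃[ t ] Γ ⊢ t ∶ ⊥
theorem2 E Γ A intro match _ ⊢A ⊢intro ⊢match match-intro =
  _ , sound-⊢ {η = []} model (λ ()) (proj₂ Hurkens.paradox)
  where
  open λHOL E
  open Soundness E
  model : Models Γ (A ∷ intro ∷ match ∷ [])
  model .Models.constants 0F = ⊢A
  model .Models.constants 1F = ⊢intro
  model .Models.constants 2F = ⊢match
  -- Under the two abstractions the context is `Γ` extended by `u` and `p`, where the assumed
  -- conversion lives.
  model .Models.conversion   = ≈-ƛ ≈-refl (≈-ƛ ≈-refl match-intro)
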